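{- Let $m\ge 3$ be an odd integer. Then the number of Klein bottle equivalence classes of $C_4$-face-magic Klein bottle labelings of $\mathcal{K}_{m,4}$ (i.e. the number of Klein bottle nonequivalent such labelings) is $2^m\,(m-1)!\,\tau(m)$, where $\tau(m)$ is the number of positive divisors of $m$.
   Context: For integers $m,n\ge 2$, the $m\times n$ Klein bottle grid graph $\mathcal{K}_{m,n}$ has vertex set $\{(i,j):1\le i\le m,\ 1\le j\le n\}$ and edges $(i,j)(i,j+1)$ for $1\le j\le n-1$; $(i,n)(i,1)$; $(i,j)(i+1,j)$ for $1\le i\le m-1$; and $(m,j)(1,n+1-j)$ for $1\le j\le n$. Its $4$-cycle faces in the natural Klein bottle embedding are, with column indices modulo $n$, $\{(i,j),(i,j+1),(i+1,j),(i+1,j+1)\}$ for $1\le i\le m-1$, $1\le j\le n$, and $\{(m,j),(m,j+1),(1,n+1-j),(1,n-j)\}$ for $1\le j\le n$. A $C_4$-face-magic Klein bottle labeling is a bijection $X=\{x_{i,j}\}$ from the vertices to $\{1,\dots,mn\}$ such that all these $4$-cycle face sums are equal. For $n$ even, define the maps on vertices $U(i,j)=(i+1,j)$ for $1\le i\le m-1$, $U(m,j)=(1,n+1-j)$; $H(i,j)=(i,j+n/2)$ (column index modulo $n$); $F(i,j)=(i,n+1-j)$. Let $KBLS(m,n)=\langle U,H,F\rangle$; these are the graph automorphisms of $\mathcal{K}_{m,n}$ induced by homeomorphisms of the Klein bottle mapping the embedded graph onto itself. For $A\in KBLS(m,n)$ and a labeling $X=\{x_{i,j}\}$ let $A(X)=\{x_{A(i,j)}\}$.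 Two $C_4$-face-magic Klein bottle labelings $X,X'$ are Klein bottle equivalent if $X'=A(X)$ for some $A\in KBLS(m,n)$. -}

module Defs where

open import Data.Nat using (ℕ; zero; suc; _+_; _*_; _∸_; _≤_; _<?_; ⌊_/2⌋)
open import Data.Nat.Divisibility using (_∣?_)
open import Data.Fin using (Fin; zero; suc; toℕ; fromℕ<; opposite)
open import Data.Product using (_×_; _,_; Σ; ∃; ∃-syntax)
open import Data.List using (List; []; _∷_; length; filter; upTo; map)
open import Data.Bool using (if_then_else_)
open import Relation.Nullary using (does; yes; no)
open import Relation.Binary.PropositionalEquality using (_≡_)
open import Function.Definitions using (Injective)
import Data.Nat as ℕ

-- Vertices of K_{m,n}: 0-indexed, vertex (i,j) here is (i+1,j+1) in the paper.
Vertex : ℕ → ℕ → Set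
Vertex m n = Fin m × Fin n

cyc : ∀ {n} → Fin n → Fin n
cyc {suc n} i with toℕ i <? n
... | yes p = suc (fromℕ< p)
... | no _  = zero

shift : ∀ {n} → ℕ → Fin n → Fin n
shift zero    j = j
shift (suc k) j = cyc (shift k j)

isLast : ∀ {m} → Fin m → _
isLast {m} i = does (suc (toℕ i) ℕ.≟ m)

U : ∀ {m n} → Vertex m n → Vertex m n
U (i , j) = (cyc i , (if isLast i then opposite j else j))

H : ∀ {m n} → Vertex m n → Vertex m n
H {n = n} (i , j) = (i , shift ⌊ n /2⌋ j)

F : ∀ {m n} → Vertex m n → Vertex m n
F (i , j) = (i , opposite j)

-- Elements of KBLS(m,n) = ⟨U,H,F⟩ as words in the generators
-- (the group is finite, so every element is a finite product of generators).
data Gen : Set where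
  gU gH gF : Gen

gen : ∀ {m n} → Gen → Vertex m n → Vertex m n
gen gU = U
gen gH = H
gen gF = F

act : ∀ {m n} → List Gen → Vertex m n → Vertex m n
act []       v = v
act (g ∷ w) v = gen g (act w v)

Labeling : ℕ → ℕ → Set
Labeling m n = Vertex m n → ℕ

IsLabeling : ∀ {m n} → Labeling m n → Set
IsLabeling {m} {n} X =
  (∀ v → 1 ≤ X v × X v ≤ m * n)
  × Injective _≡_ _≡_ X
  × (∀ k → 1 ≤ k → k ≤ m * n → ∃[ v ] X v ≡ k)

-- Sum of the 4-cycle face with "corner" (i,j) (0-indexed, columns mod n):
--  for i < m-1 : {(i,j),(i,j+1),(i+1,j),(i+1,j+1)}
--  for i = m-1 : {(m-1,j),(m-1,j+1),(0,n-1-j),(0,n-1-(j+1 mod n))}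
--    (paper: {(m,j),(m,j+1),(1,n+1-j),(1,n-j)}, 1-indexed)
faceSum : ∀ {m n} → Labeling m n → Fin m → Fin n → ℕ
faceSum X i j =
  if isLast i
  then X (i , j) + X (i , cyc j) + X (cyc i , opposite j) + X (cyc i , opposite (cyc j))
  else X (i , j) + X (i , cyc j) + X (cyc i , j) + X (cyc i , cyc j)

IsFaceMagic : ∀ {m n} → Labeling m n → Set
IsFaceMagic {m} {n} X = ∃[ c ] (∀ (i : Fin m) (j : Fin n) → faceSum X i j ≡ c)

IsMagicLabeling : ∀ {m n} → Labeling m n → Set
IsMagicLabeling X = IsLabeling X × IsFaceMagic X

applyTo : ∀ {m n} → List Gen → Labeling m n → Labeling m n
applyTo w X v = X (act w v)

KBEquivalent : ∀ {m n} → Labeling m n → Labeling m n → Set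
KBEquivalent X X' = ∃[ w ] (∀ v → X' v ≡ applyTo w X v)

-- "The number of Klein bottle equivalence classes of C4-face-magic labelings
--  of K_{m,n} is k": there is a system of k representatives, all face-magic
--  labelings, pairwise non-equivalent, such that every face-magic labeling
--  is equivalent to one of them.
NumberOfClasses : ℕ → ℕ → ℕ → Set
NumberOfClasses m n k =
  Σ (Fin k → Labeling m n) λ r →
      (∀ a → IsMagicLabeling (r a))
    × (∀ a b → KBEquivalent (r a) (r b) → a ≡ b)
    × (∀ X → IsMagicLabeling X → ∃[ a ] KBEquivalent (r a) X)

τ : ℕ → ℕ
τ m = length (filter (_∣? m) (map suc (upTo m)))

{-# OPTIONS --safe #-}
module Submission where

-- The group ⟨U,H,F⟩ is abelian and transitive on the 4m vertices, hence acts
-- regularly, and each class has exactly one labeling with 4m at the origin.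
--
-- Since m is odd, the face conditions say that x₁ + x₂ = x₀ + x₃ = 4m + 1 in
-- every row and that x₀ - x₂ = x₁ - x₃ = ±e with the sign alternating from row
-- to row.  So the labels are matched into pairs at distance e; such a matching
-- of an interval of length 4m exists only if e ∣ 2m, and is then unique: the
-- lower elements are those in the even blocks of length e.  Numbering them
-- 0,…,2m-1, the reflection z ↦ 4m + 1 - z becomes k ↦ 2m - 1 - k, and every row
-- uses one of the m reflection orbits in one of two orientations.  Once row 0
-- is normalised this leaves (m-1)! orders, 2^(m-1) orientations and
-- τ(2m) = 2 τ(m) values of e.

open import Defs
open import Data.Bool using (Bool; true; false; not; _xor_)
open import Data.Bool.Properties using (xor-assoc; xor-same; xor-identityʳ; not-involutive)
open import Data.Fin using (Fin; zero; suc; toℕ; fromℕ; fromℕ<; inject₁; opposite; punchIn; punchOut; combine; remQuot; finToFun; funToFin)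
open import Data.Fin.Induction using (<-weakInduction; >-weakInduction)
open import Data.Fin.Patterns using (0F; 1F; 2F; 3F)
open import Data.Fin.Properties as Fin using (toℕ-injective; toℕ-fromℕ; toℕ-fromℕ<; fromℕ<-injective; toℕ-inject₁; toℕ<n; any?; injective⇒≤; punchIn-injective; punchOut-injective; punchIn-punchOut; punchInᵢ≢i; remQuot-combine; combine-remQuot; funToFin-finToFin; finToFun-funToFin; 2↔Bool)
open import Data.Fin.Relation.Unary.Top using (view; ‵fromℕ; ‵inject₁)
open import Data.List using (List; []; _∷_; _++_; lookup; filter; upTo; map)
open import Data.List.Membership.Propositional using (_∈_)
open import Data.List.Membership.Propositional.Properties using (∈-filter⁺; ∈-filter⁻; ∈-map⁺; ∈-upTo⁺; ∈-lookup)
import Data.List.Relation.Unary.All as All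
open import Data.List.Relation.Unary.AllPairs using (_∷_)
open import Data.List.Relation.Unary.Any using (index)
open import Data.List.Relation.Unary.Any.Properties using (lookup-index)
open import Data.List.Relation.Unary.Unique.Propositional using (Unique)
import Data.List.Relation.Unary.Unique.Propositional.Properties as Unique
open import Data.Nat using (ℕ; zero; suc; pred; _+_; _*_; _^_; _∸_; _/_; _%_; _!; _≤_; _<_; _<?_; _≟_; z≤n; s≤s; ⌊_/2⌋; NonZero; >-nonZero; >-nonZero⁻¹)
open import Data.Nat.Divisibility using (_∣_; _∣?_; divides; ∣⇒≤; 0∣⇒≡0; ∣-trans; n∣m*n; n∣m⇒m%n≡0)
open import Data.Nat.DivMod using (m≡m%n+[m/n]*n; m%n<n; [m+kn]%n≡m%n; m<n⇒m%n≡m; m<n*o⇒m/o<n)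
open import Data.Nat.Induction using (<-rec)
open import Data.Nat.Primality using (euclidsLemma; prime[2])
open import Data.Nat.Properties hiding (_≟_; _<?_)
open import Data.Nat.Tactic.RingSolver using (solve-∀)
open import Data.Product using (_×_; _,_; ∃-syntax; proj₁; proj₂; uncurry)
open import Data.Sum using (inj₁; inj₂)
open import Function.Base using (_∘_)
open import Function.Bundles using (Inverse)
open import Function.Definitions using (Injective)
open import Relation.Binary.PropositionalEquality
open import Relation.Nullary using (yes; no; contradiction)
open import Relation.Nullary.Decidable using (dec-true; dec-false)

private variable n m : ℕ

-- The symmetry group

isLast-inject₁ : (i : Fin n) → isLast (inject₁ i) ≡ false
isLast-inject₁ {n} i = dec-false (suc (toℕ (inject₁ i)) ≟ suc n)
  λ eq → <-irrefl (trans (sym (toℕ-inject₁ i)) (suc-injective eq)) (toℕ<n i)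

isLast-fromℕ : ∀ n → isLast (fromℕ n) ≡ true
isLast-fromℕ n = dec-true (suc (toℕ (fromℕ n)) ≟ suc n) (cong suc (toℕ-fromℕ n))

cyc-inject₁ : (i : Fin n) → cyc (inject₁ i) ≡ suc i
cyc-inject₁ {n} i with toℕ (inject₁ i) <? n
... | yes p = cong suc (toℕ-injective (trans (toℕ-fromℕ< p) (toℕ-inject₁ i)))
... | no ¬p = contradiction (subst (_< n) (sym (toℕ-inject₁ i)) (toℕ<n i)) ¬p

cyc-fromℕ : ∀ n → cyc (fromℕ n) ≡ zero
cyc-fromℕ n with toℕ (fromℕ n) <? n
... | yes p = contradiction (subst (_< n) (toℕ-fromℕ n) p) (n≮n n)
... | no _  = refl

U-inject₁ : (i : Fin n) (j : Fin 4) → U (inject₁ i , j) ≡ (suc i , j)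
U-inject₁ i j rewrite cyc-inject₁ i | isLast-inject₁ i = refl

U-fromℕ : ∀ n (j : Fin 4) → U (fromℕ n , j) ≡ (zero , opposite j)
U-fromℕ n j rewrite cyc-fromℕ n | isLast-fromℕ n = refl

-- Reversal conjugates a cyclic shift to its inverse, and a shift by two of four columns is its own
-- inverse. This is what makes the group abelian.
shift-opposite : (j : Fin 4) → shift 2 (opposite j) ≡ opposite (shift 2 j)
shift-opposite 0F = refl
shift-opposite 1F = refl
shift-opposite 2F = refl
shift-opposite 3F = refl

U∘H : (v : Vertex (suc n) 4) → U (H v) ≡ H (U v)
U∘H (i , j) with isLast i
... | true  = cong (cyc i ,_) (sym (shift-opposite j))
... | false = refl

U∘F : (v : Vertex (suc n) 4) → U (F v) ≡ F (U v)
U∘F (i , j) with isLast i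
... | true  = refl
... | false = refl

H∘F : (v : Vertex (suc n) 4) → H (F v) ≡ F (H v)
H∘F (i , j) = cong (i ,_) (shift-opposite j)

gen-comm : ∀ g h (v : Vertex (suc n) 4) → gen g (gen h v) ≡ gen h (gen g v)
gen-comm gU gU v = refl
gen-comm gU gH v = U∘H v
gen-comm gU gF v = U∘F v
gen-comm gH gU v = sym (U∘H v)
gen-comm gH gH v = refl
gen-comm gH gF v = H∘F v
gen-comm gF gU v = sym (U∘F v)
gen-comm gF gH v = sym (H∘F v)
gen-comm gF gF v = refl

gen-act-comm : ∀ g w (v : Vertex (suc n) 4) → gen g (act w v) ≡ act w (gen g v)
gen-act-comm g []      v = refl
gen-act-comm g (h ∷ w) v = trans (gen-comm g h (act w v)) (cong (gen h) (gen-act-comm g w v))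

act-comm : ∀ w w′ (v : Vertex (suc n) 4) → act w (act w′ v) ≡ act w′ (act w v)
act-comm []      w′ v = refl
act-comm (g ∷ w) w′ v = trans (cong (gen g) (act-comm w w′ v)) (gen-act-comm g w′ (act w v))

act-++ : ∀ w w′ (v : Vertex (suc n) 4) → act (w ++ w′) v ≡ act w (act w′ v)
act-++ []      w′ v = refl
act-++ (g ∷ w) w′ v = cong (gen g) (act-++ w w′ v)

origin : Vertex (suc n) 4
origin = zero , zero

-- `H` and `F` generate a Klein four-group that is simply transitive on the columns of each row;
-- moving between rows is left to `U`.
toColumn : (i : Fin (suc n)) (j : Fin 4) → ∃[ w ] act w (i , zero) ≡ (i , j)
toColumn i 0F = [] , refl
toColumn i 1F = gH ∷ gF ∷ [] , refl
toColumn i 2F = gH ∷ [] , refl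
toColumn i 3F = gF ∷ [] , refl

fromColumn : (i : Fin (suc n)) (j : Fin 4) → ∃[ w ] act w (i , j) ≡ (i , zero)
fromColumn i 0F = [] , refl
fromColumn i 1F = gH ∷ gF ∷ [] , refl
fromColumn i 2F = gH ∷ [] , refl
fromColumn i 3F = gF ∷ [] , refl

fromOrigin : (v : Vertex (suc n) 4) → ∃[ w ] act w origin ≡ v
fromOrigin {n} (i , j) =
  let w , p = toRow i ; w′ , q = toColumn i j
  in w′ ++ w , trans (act-++ w′ w origin) (trans (cong (act w′) p) q)
  where
  toRow : (i : Fin (suc n)) → ∃[ w ] act w origin ≡ (i , zero)
  toRow = <-weakInduction _ ([] , refl)
    λ i (w , p) → gU ∷ w , trans (cong U p) (U-inject₁ i zero)

-- Words contain no inverse generators, so the walk goes on through the last row and wraps round to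
-- row 0. The crossing reverses the columns, which `fromColumn` then repairs.
toOrigin : (v : Vertex (suc n) 4) → ∃[ w ] act w v ≡ origin
toOrigin {n} (i , j) = fromRow i j
  where
  fromRow : (i : Fin (suc n)) → ∀ j → ∃[ w ] act w (i , j) ≡ origin
  fromRow = >-weakInduction _
    (λ j → let w , p = fromColumn zero (opposite j)
           in w ++ gU ∷ [] , trans (act-++ w _ _) (trans (cong (act w) (U-fromℕ n j)) p))
    (λ i ih j → let w , p = ih j
                in w ++ gU ∷ [] , trans (act-++ w _ _) (trans (cong (act w) (U-inject₁ i j)) p))

-- A transitive abelian group of permutations acts freely.
fixes-origin⇒id : ∀ w → act w (origin {n}) ≡ origin → ∀ v → act w v ≡ v
fixes-origin⇒id w fix v with fromOrigin v
... | w′ , refl = trans (act-comm w w′ origin) (cong (act w′) fix)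

-- A word that brings the image of the origin back composes with `w` to a word fixing the origin,
-- hence to the identity.
inverse : ∀ {n} w → ∃[ w′ ] ((v : Vertex (suc n) 4) → act w′ (act w v) ≡ v)
inverse w =
  let w′ , p = toOrigin (act w origin)
  in w′ , λ v → trans (sym (act-++ w′ w v)) (fixes-origin⇒id (w′ ++ w) (trans (act-++ w′ w origin) p) v)

-- Face sums and their invariance under the group

face : Labeling (suc n) 4 → Fin (suc n) → Fin 4 → Fin 4 → ℕ
face X i j k = X (i , j) + X (i , k) + X (U (i , j)) + X (U (i , k))

-- Reaching the second row through `U` absorbs the case split on the last row. The two columns are
-- separate arguments of `face` so that a face can be read in either direction, as reversals
-- require.
faceSum≡face : (X : Labeling (suc n) 4) → ∀ i j → faceSum X i j ≡ face X i j (cyc j)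
faceSum≡face X i j with isLast i
... | true  = refl
... | false = refl

face-sym : (X : Labeling (suc n) 4) → ∀ i j k → face X i j k ≡ face X i k j
face-sym X i j k = swap (X (i , j)) (X (i , k)) (X (U (i , j))) (X (U (i , k)))
  where
  swap : ∀ a b c d → a + b + c + d ≡ b + a + d + c
  swap = solve-∀

opposite-cyc : (j : Fin 4) → opposite j ≡ cyc (opposite (cyc j))
opposite-cyc 0F = refl
opposite-cyc 1F = refl
opposite-cyc 2F = refl
opposite-cyc 3F = refl

AllFaces : Labeling (suc n) 4 → ℕ → Set
AllFaces X c = ∀ i j → face X i j (cyc j) ≡ c

module _ (X : Labeling (suc n) 4) {c : ℕ} (magic : AllFaces X c) where

  -- Reversal sends the edge from `j` to `cyc j` to an edge between cyclic neighbours traversed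
  -- backwards, so the result is again one of the listed faces.
  face-opposite : ∀ i j → face X i (opposite j) (opposite (cyc j)) ≡ c
  face-opposite i j =
    trans (face-sym X i (opposite j) (opposite (cyc j)))
      (trans (cong (face X i (opposite (cyc j))) (opposite-cyc j)) (magic i (opposite (cyc j))))

  gen-faces : ∀ g → AllFaces (λ v → X (gen g v)) c
  gen-faces gU i j with isLast i
  ... | true  = face-opposite (cyc i) j
  ... | false = magic (cyc i) j
  gen-faces gH i j =
    trans (cong₂ (λ a b → X (H (i , j)) + X (H (i , cyc j)) + X a + X b)
                 (sym (U∘H (i , j))) (sym (U∘H (i , cyc j))))
          (magic i (shift 2 j))
  gen-faces gF i j =
    trans (cong₂ (λ a b → X (F (i , j)) + X (F (i , cyc j)) + X a + X b)
                 (sym (U∘F (i , j))) (sym (U∘F (i , cyc j))))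
          (face-opposite i j)

act-faces : ∀ w (X : Labeling (suc n) 4) {c} → AllFaces X c → AllFaces (applyTo w X) c
act-faces []      X magic = magic
act-faces (g ∷ w) X magic = act-faces w (λ v → X (gen g v)) (gen-faces X magic g)

allFaces : (X : Labeling (suc n) 4) → IsFaceMagic X → ∃[ c ] AllFaces X c
allFaces X (c , magic) = c , λ i j → trans (sym (faceSum≡face X i j)) (magic i j)

isFaceMagic : (X : Labeling (suc n) 4) {c : ℕ} → AllFaces X c → IsFaceMagic X
isFaceMagic X {c} magic = c , λ i j → trans (faceSum≡face X i j) (magic i j)

applyTo-magic : ∀ w (X : Labeling (suc n) 4) → IsMagicLabeling X → IsMagicLabeling (applyTo w X)
applyTo-magic w X ((range , inj , onto) , magic) =
  let w′ , inv = inverse w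
      act-injective = λ {u v} (eq : act w u ≡ act w v) → trans (sym (inv u)) (trans (cong (act w′) eq) (inv v))
  in ( (λ v → range (act w v))
     , (λ eq → act-injective (inj eq))
     , (λ k 1≤k k≤ → let v , Xv≡k = onto k 1≤k k≤
                     in act w′ v , trans (cong X (trans (act-comm w w′ v) (inv v))) Xv≡k) )
     , isFaceMagic (applyTo w X) (act-faces w X (proj₂ (allFaces X magic)))

-- Row laws equivalent to the face conditions

parity : Fin n → Bool
parity zero    = false
parity (suc i) = not (parity i)

parity-inject₁ : (i : Fin n) → parity (inject₁ i) ≡ parity i
parity-inject₁ zero    = refl
parity-inject₁ (suc i) = cong not (parity-inject₁ i)

parity-fromℕ : ∀ n → suc n % 2 ≡ 1 → parity (fromℕ n) ≡ false
parity-fromℕ zero          odd = refl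
parity-fromℕ (suc (suc n)) odd = trans (not-involutive _) (parity-fromℕ n odd)

-- The first argument chooses between the column pairs 0, 2 and 1, 3; the second chooses within the
-- pair, `true` being the larger label in an even row.
column : Bool → Bool → Fin 4
column false true  = 0F
column true  true  = 1F
column false false = 2F
column true  false = 3F

side : Fin 4 → Bool
side 0F = false
side 1F = true
side 2F = false
side 3F = true

high : Fin 4 → Bool
high 0F = true
high 1F = true
high 2F = false
high 3F = false

-- Odd rows are read two columns further, so that every row obeys the same law.
row : (Fin 4 → ℕ) → Bool → Bool → Bool → ℕ
row x p s h = x (column s (h xor p))

-- The constant `T` stays free here; only the presence of the labels 1 and 4m forces it to be 4m +
-- 1.
record RowLaw (e T : ℕ) (y : Bool → Bool → ℕ) : Set where
  field
    step   : ∀ s → y s true ≡ y s false + e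
    mirror : ∀ h → y false h + y true (not h) ≡ T

open RowLaw

-- Reversal exchanges both the sides and the upper and lower entries, so it acts like a change of
-- row parity. With m odd the last row and row 0 are both even, and this makes the seam between them
-- look like any two adjacent rows.
rowLaw-opposite : ∀ {e T x} p → RowLaw e T (row x p) → RowLaw e T (row (λ j → x (opposite j)) (not p))
rowLaw-opposite {e} {T} {x} p law = record
  { step   = λ s → subst₂ (λ a b → x a ≡ x b + e) (flip p s true) (flip p s false) (law .step (not s))
  ; mirror = λ h → subst₂ (λ a b → x a + x b ≡ T) (flip p false h) (flip p true (not h))
      (trans (+-comm (row x p true h) _)
        (trans (cong (λ k → row x p false (not h) + row x p true k) (sym (not-involutive h))) (law .mirror (not h))))
  }
  where
  flip : ∀ p s h → column (not s) (h xor p) ≡ opposite (column s (h xor not p))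
  flip false false false = refl
  flip false false true  = refl
  flip false true  false = refl
  flip false true  true  = refl
  flip true  false false = refl
  flip true  false true  = refl
  flip true  true  false = refl
  flip true  true  true  = refl

module _ {e T : ℕ} where

  private
    cross : ∀ {a a′ b c c′ d} → a ≡ a′ + e → c′ ≡ c + e → a′ + b ≡ T → c′ + d ≡ T → a + b + c + d ≡ T + T
    cross {a′ = a′} {b} {c} {d = d} refl refl p q = trans (rearrange a′ b c d e) (cong₂ _+_ p q)
      where
      rearrange : ∀ a b c d e → a + e + b + c + d ≡ (a + b) + ((c + e) + d)
      rearrange = solve-∀

    cross′ : ∀ {a a′ b c c′ d} → a′ ≡ a + e → c ≡ c′ + e → a′ + b ≡ T → c′ + d ≡ T → a + b + c + d ≡ T + T
    cross′ {a = a} {b = b} {c′ = c′} {d = d} refl refl p q = trans (rearrange a b c′ d e) (cong₂ _+_ p q)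
      where
      rearrange : ∀ a b c d e → a + b + (c + e) + d ≡ (a + e + b) + (c + d)
      rearrange = solve-∀

    pair : ∀ a b c d → a + b ≡ T → c + d ≡ T → a + b + c + d ≡ T + T
    pair a b c d p q = trans (+-assoc (a + b) c d) (cong₂ _+_ p q)

  -- Columns 1, 2 and columns 3, 0 sum to `T` in each row separately. For columns 0, 1 and 2, 3 one
  -- row exceeds `T` by `e` and the row of opposite parity falls short by `e`.
  adjacentRows : ∀ x x′ p → RowLaw e T (row x p) → RowLaw e T (row x′ (not p)) →
                 ∀ j → x j + x (cyc j) + x′ j + x′ (cyc j) ≡ T + T
  adjacentRows x x′ false l l′ 0F = cross (l .step false) (l′ .step false) (l .mirror false) (l′ .mirror true)
  adjacentRows x x′ false l l′ 1F =
    pair (x 1F) (x 2F) (x′ 1F) (x′ 2F)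
         (trans (+-comm (x 1F) _) (l .mirror false)) (trans (+-comm (x′ 1F) _) (l′ .mirror true))
  adjacentRows x x′ false l l′ 2F = cross′ (l .step false) (l′ .step false) (l .mirror true) (l′ .mirror false)
  adjacentRows x x′ false l l′ 3F =
    pair (x 3F) (x 0F) (x′ 3F) (x′ 0F)
         (trans (+-comm (x 3F) _) (l .mirror true)) (trans (+-comm (x′ 3F) _) (l′ .mirror false))
  adjacentRows x x′ true l l′ 0F = cross′ (l .step false) (l′ .step false) (l .mirror true) (l′ .mirror false)
  adjacentRows x x′ true l l′ 1F =
    pair (x 1F) (x 2F) (x′ 1F) (x′ 2F)
         (trans (+-comm (x 1F) _) (l .mirror true)) (trans (+-comm (x′ 1F) _) (l′ .mirror false))
  adjacentRows x x′ true l l′ 2F = cross (l .step false) (l′ .step false) (l .mirror false) (l′ .mirror true)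
  adjacentRows x x′ true l l′ 3F =
    pair (x 3F) (x 0F) (x′ 3F) (x′ 0F)
         (trans (+-comm (x 3F) _) (l .mirror false)) (trans (+-comm (x′ 3F) _) (l′ .mirror true))

RowLaws : ℕ → ℕ → Labeling (suc n) 4 → Set
RowLaws e T X = ∀ i → RowLaw e T (row (λ j → X (i , j)) (parity i))

rows⇒faces : ∀ {e T} (X : Labeling (suc n) 4) → parity (fromℕ n) ≡ false → RowLaws e T X → AllFaces X (T + T)
rows⇒faces {n} {e} {T} X even law i j with view i
... | ‵inject₁ i′ rewrite U-inject₁ i′ j | U-inject₁ i′ (cyc j) =
      adjacentRows (λ j → X (inject₁ i′ , j)) (λ j → X (suc i′ , j)) (parity i′)
        (subst (λ p → RowLaw e T (row (λ j → X (inject₁ i′ , j)) p)) (parity-inject₁ i′) (law (inject₁ i′)))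
        (law (suc i′)) j
... | ‵fromℕ rewrite U-fromℕ n j | U-fromℕ n (cyc j) =
      adjacentRows (λ j → X (fromℕ n , j)) (λ j → X (zero , opposite j)) false
        (subst (λ p → RowLaw e T (row (λ j → X (fromℕ n , j)) p)) even (law (fromℕ n)))
        (rowLaw-opposite {x = λ j → X (zero , j)} false (law zero)) j

-- The odd case is `y = c − a`, written additively to avoid truncated subtraction.
Alternates : ℕ → ℕ → Bool → ℕ → Set
Alternates c a false y = y ≡ a
Alternates c a true  y = a + y ≡ c

alternation : ∀ {c} (f : Fin (suc n) → ℕ) → (∀ i → f (inject₁ i) + f (suc i) ≡ c) →
              ∀ i → Alternates c (f zero) (parity i) (f i)
alternation {c = c} f sum = <-weakInduction _ refl next
  where
  next : ∀ i → Alternates c (f zero) (parity (inject₁ i)) (f (inject₁ i)) →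
         Alternates c (f zero) (not (parity i)) (f (suc i))
  next i ih rewrite parity-inject₁ i with parity i
  ... | false = trans (cong (_+ f (suc i)) (sym ih)) (sum i)
  ... | true  = +-cancelˡ-≡ (f (inject₁ i)) _ _
                  (trans (sum i) (trans (sym ih) (+-comm (f zero) (f (inject₁ i)))))

double-injective : ∀ a b → a + a ≡ b + b → a ≡ b
double-injective a b eq = trans (n≡⌊n+n/2⌋ a) (trans (cong ⌊_/2⌋ eq) (sym (n≡⌊n+n/2⌋ b)))

module _ (X : Labeling (suc n) 4) {c : ℕ} (magic : AllFaces X c) (even : parity (fromℕ n) ≡ false) where

  private
    pairSum : Fin 4 → Fin (suc n) → ℕ
    pairSum j i = X (i , j) + X (i , cyc j)

    alternating : ∀ j i → Alternates c (pairSum j zero) (parity i) (pairSum j i)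
    alternating j = alternation (pairSum j) λ i →
      trans (sym (+-assoc (pairSum j (inject₁ i)) (X (suc i , j)) _))
        (trans (cong₂ (λ u v → pairSum j (inject₁ i) + X u + X v) (sym (U-inject₁ i j)) (sym (U-inject₁ i (cyc j))))
          (magic (inject₁ i) j))

    -- Here m odd enters: the alternation along the rows ends at its initial value, so the faces
    -- across the seam compare row 0 with its own reversal.
    last≡first : ∀ j → pairSum j (fromℕ n) ≡ pairSum j zero
    last≡first j = subst (λ p → Alternates c (pairSum j zero) p (pairSum j (fromℕ n))) even (alternating j (fromℕ n))

    wrap : ∀ j → pairSum j zero + (X (zero , opposite j) + X (zero , opposite (cyc j))) ≡ c
    wrap j = trans (cong (_+ (X (zero , opposite j) + X (zero , opposite (cyc j)))) (sym (last≡first j)))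
      (trans (sym (+-assoc (pairSum j (fromℕ n)) (X (zero , opposite j)) _))
        (trans (cong₂ (λ u v → pairSum j (fromℕ n) + X u + X v) (sym (U-fromℕ n j)) (sym (U-fromℕ n (cyc j))))
          (magic (fromℕ n) j)))

    constant : ∀ {j} → pairSum j zero + pairSum j zero ≡ c → ∀ i → pairSum j i ≡ pairSum j zero
    constant {j} double i with parity i | alternating j i
    ... | false | eq = eq
    ... | true  | eq = +-cancelˡ-≡ (pairSum j zero) _ _ (trans eq (sym double))

    T : ℕ
    T = pairSum 1F zero

    -- Reversal maps the column pair 1, 2 to itself, and likewise 3, 0. Across the seam the same
    -- pair sum is met again, so it is half of `c` and its alternation collapses to a constant.
    double₁ : T + T ≡ c
    double₁ = trans (cong (T +_) (+-comm (X (zero , 1F)) _)) (wrap 1F)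

    double₃ : pairSum 3F zero + pairSum 3F zero ≡ c
    double₃ = trans (cong (pairSum 3F zero +_) (+-comm (X (zero , 3F)) _)) (wrap 3F)

    sum₁ : ∀ i → pairSum 1F i ≡ T
    sum₁ = constant double₁

    sum₃ : ∀ i → pairSum 3F i ≡ T
    sum₃ i = trans (constant double₃ i) (double-injective _ _ (trans double₃ (sym double₁)))

    -- Because x₁ + x₂ = T, the difference x₀ - x₂ equals (x₀ + x₁) - T. The sum x₀ + x₁ is that of
    -- row 0 in even rows and its complement to `c = T + T` in odd rows, which reverses the sign in
    -- `oddStep`.
    evenStep : ∀ {x₀ x₁ x₂ y₀ y₁ y₂ e} → x₁ + x₂ ≡ T → y₁ + y₂ ≡ T → y₀ ≡ y₂ + e →
               x₀ + x₁ ≡ y₀ + y₁ → x₀ ≡ x₂ + e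
    evenStep {x₀} {x₁} {x₂} {y₁ = y₁} {y₂} {e} p q refl eq = +-cancelˡ-≡ (x₁ + y₂) _ _ (begin
      x₁ + y₂ + x₀        ≡⟨ rearrange x₁ y₂ x₀ ⟩
      x₀ + x₁ + y₂        ≡⟨ cong (_+ y₂) eq ⟩
      y₂ + e + y₁ + y₂    ≡⟨ rearrange′ y₁ y₂ e ⟩
      (y₁ + y₂) + e + y₂  ≡⟨ cong (λ t → t + e + y₂) (trans q (sym p)) ⟩
      (x₁ + x₂) + e + y₂  ≡⟨ rearrange″ x₁ x₂ e y₂ ⟩
      x₁ + y₂ + (x₂ + e)  ∎)
      where
      open ≡-Reasoning
      rearrange : ∀ a b c → a + b + c ≡ c + a + b
      rearrange = solve-∀
      rearrange′ : ∀ a b e → b + e + a + b ≡ (a + b) + e + b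
      rearrange′ = solve-∀
      rearrange″ : ∀ a b e c → a + b + e + c ≡ a + c + (b + e)
      rearrange″ = solve-∀

    oddStep : ∀ {x₀ x₁ x₂ y₀ y₁ y₂ e} → x₁ + x₂ ≡ T → y₁ + y₂ ≡ T → y₀ ≡ y₂ + e →
              y₀ + y₁ + (x₀ + x₁) ≡ c → x₂ ≡ x₀ + e
    oddStep {x₀} {x₁} {x₂} {y₁ = y₁} {y₂} {e} p q refl eq = +-cancelˡ-≡ (T + x₁) _ _ (begin
      T + x₁ + x₂                 ≡⟨ +-assoc T x₁ x₂ ⟩
      T + (x₁ + x₂)               ≡⟨ cong (T +_) p ⟩
      T + T                       ≡⟨ double₁ ⟩
      c                           ≡⟨ eq ⟨
      y₂ + e + y₁ + (x₀ + x₁)     ≡⟨ rearrange y₁ y₂ e x₀ x₁ ⟩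
      (y₁ + y₂) + x₁ + (x₀ + e)   ≡⟨ cong (λ t → t + x₁ + (x₀ + e)) q ⟩
      T + x₁ + (x₀ + e)           ∎)
      where
      open ≡-Reasoning
      rearrange : ∀ a b e c d → b + e + a + (c + d) ≡ (a + b) + d + (c + e)
      rearrange = solve-∀

    mirrorStep : ∀ {a b c d e} → a + b ≡ T → c + d ≡ T → d ≡ b + e → a ≡ c + e
    mirrorStep {a} {b} {c} {e = e} p q refl = +-cancelˡ-≡ b _ _
      (trans (+-comm b a) (trans p (trans (sym q) (rearrange c b e))))
      where
      rearrange : ∀ c b e → c + (b + e) ≡ b + (c + e)
      rearrange = solve-∀

  faces⇒rows : ∀ {e} → X (zero , 0F) ≡ X (zero , 2F) + e → ∃[ T ] RowLaws e T X
  faces⇒rows {e} diff = T , law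
    where
    law : RowLaws e T X
    law i with parity i | alternating 0F i
    ... | false | eq = record
      { step   = λ { false → d ; true → mirrorStep (sum₁ i) (sum₃ i) d }
      ; mirror = λ { false → trans (+-comm _ (X (i , 1F))) (sum₁ i) ; true → trans (+-comm _ (X (i , 3F))) (sum₃ i) } }
      where
      d : X (i , 0F) ≡ X (i , 2F) + e
      d = evenStep (sum₁ i) (sum₁ zero) diff eq
    ... | true | eq = record
      { step   = λ { false → d ; true → mirrorStep (sum₃ i) (sum₁ i) d }
      ; mirror = λ { false → trans (+-comm _ (X (i , 3F))) (sum₃ i) ; true → trans (+-comm _ (X (i , 1F))) (sum₁ i) } }
      where
      d : X (i , 2F) ≡ X (i , 0F) + e
      d = oddStep (sum₁ i) (sum₁ zero) diff eq

-- Matchings at a fixed distance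

divMod-unique : ∀ {n r r′} q q′ → r < n → r′ < n → r + q * n ≡ r′ + q′ * n → r ≡ r′ × q ≡ q′
divMod-unique {n@(suc _)} {r} {r′} q q′ r<n r′<n eq = r≡r′ , *-cancelʳ-≡ q q′ n (+-cancelˡ-≡ r _ _
  (trans eq (cong (_+ q′ * n) (sym r≡r′))))
  where
  remainder : ∀ {r} q → r < n → (r + q * n) % n ≡ r
  remainder {r} q r<n = trans ([m+kn]%n≡m%n r q n) (m<n⇒m%n≡m r<n)
  r≡r′ : r ≡ r′
  r≡r′ = trans (sym (remainder q r<n)) (trans (cong (_% n) eq) (remainder q′ r′<n))

bit : Bool → ℕ
bit false = 0
bit true  = 1

bit<2 : ∀ b → bit b < 2
bit<2 false = s≤s z≤n
bit<2 true  = s≤s (s≤s z≤n)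

bit-injective : ∀ a b → bit a ≡ bit b → a ≡ b
bit-injective false false _ = refl
bit-injective true  true  _ = refl

module _ (e : ℕ) .{{_ : NonZero e}} where

  -- Cut ℕ into blocks of length e: slot false lists the elements of the even
  -- blocks in increasing order, slot true those of the odd blocks.
  slot : Bool → ℕ → ℕ
  slot h k = k % e + (bit h + k / e * 2) * e

  slot-+* : ∀ {r} → r < e → ∀ h q → slot h (r + q * e) ≡ r + (bit h + q * 2) * e
  slot-+* {r} r<e h q =
    let p , p′ = divMod-unique (k / e) q (m%n<n k e) r<e (sym (m≡m%n+[m/n]*n k e))
    in cong₂ (λ a b → a + (bit h + b * 2) * e) p p′
    where k = r + q * e

  -- Division by `e` and then by 2 recovers the remainder, the bit and the quotient from which the
  -- value was assembled.
  slot-injective : ∀ h h′ k k′ → slot h k ≡ slot h′ k′ → h ≡ h′ × k ≡ k′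
  slot-injective h h′ k k′ eq =
    let p , p′ = divMod-unique _ _ (m%n<n k e) (m%n<n k′ e) eq
        q , q′ = divMod-unique (k / e) (k′ / e) (bit<2 h) (bit<2 h′) p′
    in bit-injective h h′ q
     , trans (m≡m%n+[m/n]*n k e) (trans (cong₂ (λ a b → a + b * e) p q′) (sym (m≡m%n+[m/n]*n k′ e)))

  slot-true : ∀ k → slot true k ≡ slot false k + e
  slot-true k = rearrange (k % e) (k / e * 2) e
    where
    rearrange : ∀ r q e → r + (1 + q) * e ≡ r + q * e + e
    rearrange = solve-∀

  -- Going `e` beyond an odd block lands in the next even block, which is one block further along
  -- the list for slot `false`.
  slot-next : ∀ k → slot false (k + e) ≡ slot true k + e
  slot-next k = begin
    slot false (k + e)                          ≡⟨ cong (λ k → slot false (k + e)) (m≡m%n+[m/n]*n k e) ⟩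
    slot false (k % e + k / e * e + e)          ≡⟨ cong (slot false) (rearrange (k % e) (k / e) e) ⟩
    slot false (k % e + suc (k / e) * e)        ≡⟨ slot-+* (m%n<n k e) false (suc (k / e)) ⟩
    k % e + (0 + suc (k / e) * 2) * e           ≡⟨ rearrange′ (k % e) (k / e) e ⟩
    slot true k + e                             ∎
    where
    open ≡-Reasoning
    rearrange : ∀ r q e → r + q * e + e ≡ r + (1 + q) * e
    rearrange = solve-∀
    rearrange′ : ∀ r q e → r + (1 + q) * 2 * e ≡ r + (1 + q * 2) * e + e
    rearrange′ = solve-∀

  slot-small : ∀ {z} → z < e → slot false z ≡ z
  slot-small {z} z<e = trans (cong (slot false) (sym (+-identityʳ z))) (trans (slot-+* z<e false 0) (+-identityʳ z))

  slot-bound : ∀ D h k → slot h k < D * 2 * e → k < D * e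
  slot-bound D h k slot< = begin-strict
    k                    ≡⟨ m≡m%n+[m/n]*n k e ⟩
    k % e + k / e * e    <⟨ +-monoˡ-< (k / e * e) (m%n<n k e) ⟩
    suc (k / e) * e      ≤⟨ *-monoˡ-≤ e q<D ⟩
    D * e                ∎
    where
    open ≤-Reasoning
    q<D : k / e < D
    q<D = *-cancelʳ-< 2 (k / e) D (*-cancelʳ-< e (k / e * 2) (D * 2)
      (≤-<-trans (≤-trans (*-monoˡ-≤ e (m≤n+m (k / e * 2) (bit h))) (m≤n+m _ (k % e))) slot<))

  -- There are 2D blocks, an even number, so the reflection exchanges even and odd blocks. In digits
  -- it sends the remainder r to e - 1 - r, flips the bit and sends the quotient q to D - 1 - q.
  slot-mirror : ∀ D h {k k′} → suc (k + k′) ≡ D * e → suc (slot h k + slot (not h) k′) ≡ D * 2 * e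
  slot-mirror D h {k} {k′} sum = begin
    suc (slot h k + slot (not h) k′)
      ≡⟨ cong (λ k → suc (slot h _ + slot (not h) k)) k′≡ ⟩
    suc (slot h k + slot (not h) (r′ + q′ * e))
      ≡⟨ cong (λ t → suc (slot h k + t)) (slot-+* r′<e (not h) q′) ⟩
    suc (r + (bit h + q * 2) * e + (r′ + (bit (not h) + q′ * 2) * e))
      ≡⟨ rearrange′ r r′ q q′ (bit h) (bit (not h)) e ⟩
    suc r + r′ + (bit h + bit (not h) + (q + q′) * 2) * e
      ≡⟨ cong₂ (λ a b → a + (b + (q + q′) * 2) * e) r+r′ (bits h) ⟩
    e + (1 + (q + q′) * 2) * e
      ≡⟨ rearrange″ e (q + q′) ⟩
    (suc (q + q′)) * 2 * e
      ≡⟨ cong (λ d → d * 2 * e) q+q′ ⟩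
    D * 2 * e ∎
    where
    open ≡-Reasoning
    r = k % e
    q = k / e
    r′ = e ∸ suc r
    q′ = D ∸ suc q
    bits : ∀ h → bit h + bit (not h) ≡ 1
    bits false = refl
    bits true  = refl
    r+r′ : suc r + r′ ≡ e
    r+r′ = m+[n∸m]≡n (m%n<n k e)
    q+q′ : suc q + q′ ≡ D
    q+q′ = m+[n∸m]≡n (m<n*o⇒m/o<n (≤-trans (s≤s (m≤m+n k k′)) (≤-reflexive sum)))
    r′<e : r′ < e
    r′<e = ≤-trans (s≤s (m≤n+m r′ r)) (≤-reflexive r+r′)
    rearrange : ∀ r r′ q q′ e → 1 + (r + q * e) + (r′ + q′ * e) ≡ (1 + r + r′) + (q + q′) * e
    rearrange = solve-∀
    rearrange′ : ∀ r r′ q q′ b b′ e → 1 + (r + (b + q * 2) * e + (r′ + (b′ + q′ * 2) * e))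
                 ≡ 1 + r + r′ + (b + b′ + (q + q′) * 2) * e
    rearrange′ = solve-∀
    rearrange″ : ∀ e q → e + (1 + q * 2) * e ≡ (1 + q) * 2 * e
    rearrange″ = solve-∀
    k′≡ : k′ ≡ r′ + q′ * e
    k′≡ = +-cancelˡ-≡ (suc k) _ _ (begin
      suc k + k′                            ≡⟨ sum ⟩
      D * e                                 ≡⟨ cong (_* e) (sym q+q′) ⟩
      e + (q + q′) * e                      ≡⟨ cong (_+ (q + q′) * e) (sym r+r′) ⟩
      suc r + r′ + (q + q′) * e             ≡⟨ rearrange r r′ q q′ e ⟨
      suc (r + q * e) + (r′ + q′ * e)       ≡⟨ cong (λ t → suc t + (r′ + q′ * e)) (sym (m≡m%n+[m/n]*n k e)) ⟩
      suc k + (r′ + q′ * e)                 ∎)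

-- A perfect matching of {0,…,N-1} into pairs at distance e is unique and
-- forces N to be a multiple of 2e.
module Matching {V : Set} (N e : ℕ) .{{_ : NonZero e}} (Z : V → ℕ)
  (Z<N : ∀ v → Z v < N) (Z-injective : Injective _≡_ _≡_ Z) (Z-onto : ∀ k → k < N → ∃[ v ] Z v ≡ k)
  (upper : V → Bool) (partner : V → V)
  (upper-partner : ∀ v → upper (partner v) ≡ not (upper v))
  (ascend : ∀ v → upper v ≡ false → Z (partner v) ≡ Z v + e)
  (descend : ∀ v → upper v ≡ true → Z v ≡ Z (partner v) + e)
  where

  -- Strong induction on the value `z`. An upper element inherits the index of its partner `e`
  -- below. A lower one with `z < e` lies in the first block; otherwise look at the vertex of value
  -- `z ∸ e`. If that is upper, the index advances by `e`; if it is lower, its partner has value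
  -- `z`, so `v` would be upper.
  inSlot : ∀ v → ∃[ k ] Z v ≡ slot e (upper v) k
  inSlot v = <-rec (λ z → ∀ v → Z v ≡ z → ∃[ k ] Z v ≡ slot e (upper v) k) body (Z v) v refl
    where
    0<e : 0 < e
    0<e = >-nonZero⁻¹ e
    body : ∀ z → (∀ {y} → y < z → ∀ v → Z v ≡ y → ∃[ k ] Z v ≡ slot e (upper v) k) →
           ∀ v → Z v ≡ z → ∃[ k ] Z v ≡ slot e (upper v) k
    body z ih v Zv≡z with upper v in up
    ... | true =
      let k , eq = ih (subst (Z (partner v) <_) (trans (sym (descend v up)) Zv≡z) (m<m+n _ 0<e)) (partner v) refl
      in k , trans (descend v up) (trans (cong (_+ e) (trans eq (cong (λ h → slot e h k) (trans (upper-partner v) (cong not up)))))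
               (sym (slot-true e k)))
    ... | false with z <? e
    ... | yes z<e = z , trans Zv≡z (sym (slot-small e z<e))
    ... | no z≮e
      with u , Zu≡ ← Z-onto (z ∸ e) (≤-<-trans (m∸n≤m z e) (subst (_< N) Zv≡z (Z<N v)))
      with upper u in up′ | ih {z ∸ e} (∸-monoʳ-< {z} 0<e (≮⇒≥ z≮e)) u Zu≡
    ... | true | k , eq = k + e , (begin
      Z v                 ≡⟨ Zv≡z ⟩
      z                   ≡⟨ m∸n+n≡m (≮⇒≥ z≮e) ⟨
      z ∸ e + e           ≡⟨ cong (_+ e) (trans (sym Zu≡) eq) ⟩
      slot e true k + e   ≡⟨ slot-next e k ⟨
      slot e false (k + e) ∎)
      where open ≡-Reasoning
    ... | false | _ = contradiction (trans (sym up) (trans (cong upper v≡) (trans (upper-partner u) (cong not up′)))) λ ()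
      where
      v≡ : v ≡ partner u
      v≡ = Z-injective (trans Zv≡z (trans (sym (m∸n+n≡m (≮⇒≥ z≮e))) (trans (cong (_+ e) (sym Zu≡)) (sym (ascend u up′)))))

  -- A lower element has a partner above it, so the largest value is upper and lies in an odd block.
  -- If it ends that block, `N` consists of whole pairs of blocks; otherwise the next position
  -- yields a contradiction.
  divides-length : ∀ v → suc (Z v) ≡ N → ∃[ D ] D * 2 * e ≡ N
  divides-length v top with upper v in up | inSlot v
  ... | false | _ = contradiction (Z<N (partner v)) (≤⇒≯ (begin
      N               ≡⟨ top ⟨
      suc (Z v)       ≤⟨ m<m+n (Z v) (>-nonZero⁻¹ e) ⟩
      Z v + e         ≡⟨ ascend v up ⟨
      Z (partner v)   ∎))
      where open ≤-Reasoning
  ... | true | k , eq with suc (k % e) <? e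
  ...   | no r≮ = suc (k / e) , (begin
      suc (k / e) * 2 * e                       ≡⟨ rearrange (k / e) e ⟩
      e + (1 + k / e * 2) * e                   ≡⟨ cong (_+ (1 + k / e * 2) * e) (≤-antisym (≮⇒≥ r≮) (m%n<n k e)) ⟩
      suc (slot e true k)                       ≡⟨ cong suc eq ⟨
      suc (Z v)                                 ≡⟨ top ⟩
      N                                         ∎)
      where
      open ≡-Reasoning
      rearrange : ∀ q e → (1 + q) * 2 * e ≡ e + (1 + q * 2) * e
      rearrange = solve-∀
  ...   | yes r< = impossible
      where
      -- This is `k + 1`, still in the same block, so `N − e` lies in an even block. Its occupant is
      -- not lower, since the partner would have value `N`, and not upper, since it would then lie
      -- in an odd block.
      k′ = suc (k % e) + k / e * e
      N≡ : slot e false k′ + e ≡ N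
      N≡ = begin
        slot e false k′ + e                              ≡⟨ cong (_+ e) (slot-+* e r< false (k / e)) ⟩
        suc (k % e) + (0 + k / e * 2) * e + e            ≡⟨ rearrange (k % e) (k / e) e ⟩
        suc (slot e true k)                              ≡⟨ cong suc eq ⟨
        suc (Z v)                                        ≡⟨ top ⟩
        N                                                ∎
        where
        open ≡-Reasoning
        rearrange : ∀ r q e → 1 + r + (q * 2) * e + e ≡ 1 + (r + (1 + q * 2) * e)
        rearrange = solve-∀
      impossible : ∃[ D ] D * 2 * e ≡ N
      impossible with u , Zu≡ ← Z-onto (slot e false k′) (subst (slot e false k′ <_) N≡ (m<m+n _ (>-nonZero⁻¹ e)))
        with upper u in up′ | inSlot u
      ... | false | _ = contradiction (Z<N (partner u)) (≤⇒≯ (≤-reflexive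
              (sym (trans (ascend u up′) (trans (cong (_+ e) Zu≡) N≡)))))
      ... | true | k″ , eq″ = contradiction (proj₁ (slot-injective e false true k′ k″ (trans (sym Zu≡) eq″))) λ ()

-- Normalised labelings

-- Pigeonhole: a missed value could be deleted from the codomain, leaving an injection into a
-- smaller set.
injective⇒onto : (f : Fin n → Fin n) → Injective _≡_ _≡_ f → ∀ y → ∃[ x ] f x ≡ y
injective⇒onto {suc n} f inj y with any? (λ x → f x Fin.≟ y)
... | yes hit = hit
... | no miss = contradiction
  (injective⇒≤ {f = λ x → punchOut (≢f x)} λ {a} {b} eq → inj (punchOut-injective (≢f a) (≢f b) eq))
  (<⇒≱ (n<1+n n))
  where
  ≢f : ∀ x → y ≢ f x
  ≢f x y≡ = miss (x , sym y≡)

isLabeling : (X : Labeling m n) → (∀ v → 1 ≤ X v × X v ≤ m * n) → Injective _≡_ _≡_ X → IsLabeling X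
isLabeling {m} {n} X range inj = range , inj , onto
  where
  predX< : ∀ v → pred (X v) < m * n
  predX< v with X v | range v
  ... | suc x | _ , x< = x<

  X≡suc-pred : ∀ v → X v ≡ suc (pred (X v))
  X≡suc-pred v with X v | range v
  ... | suc x | _ = refl

  f : Fin (m * n) → Fin (m * n)
  f k = fromℕ< (predX< (remQuot {m} n k))

  f-injective : Injective _≡_ _≡_ f
  f-injective {a} {b} eq =
    trans (sym (combine-remQuot {m} n a)) (trans (cong (uncurry combine) (inj X≡)) (combine-remQuot {m} n b))
    where
    X≡ : X (remQuot {m} n a) ≡ X (remQuot {m} n b)
    X≡ = trans (X≡suc-pred _) (trans (cong suc (fromℕ<-injective _ _ _ _ eq)) (sym (X≡suc-pred _)))

  onto : ∀ k → 1 ≤ k → k ≤ m * n → ∃[ v ] X v ≡ k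
  onto (suc k) _ k< =
    let x , eq = injective⇒onto f f-injective (fromℕ< k<)
    in remQuot {m} n x , trans (X≡suc-pred _) (cong suc (fromℕ<-injective _ _ _ _ eq))

-- Coordinates on the numbers below 2m adapted to the reflection k ↦ 2m - 1 - k: an orbit and a
-- choice of one of its two members.
signed : Fin m → Bool → ℕ
signed     p false = toℕ p
signed {m} p true  = m * 2 ∸ suc (toℕ p)

signed-mirror : ∀ (p : Fin m) b → suc (signed p b + signed p (not b)) ≡ m * 2
signed-mirror {m} p false = m+[n∸m]≡n (≤-trans (toℕ<n p) (m≤m*n m 2))
signed-mirror {m} p true  = trans (cong suc (+-comm _ (toℕ p))) (signed-mirror p false)

signed-injective : ∀ (p q : Fin m) b c → signed p b ≡ signed q c → p ≡ q × b ≡ c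
signed-injective p q false false eq = toℕ-injective eq , refl
signed-injective p q true  true  eq = toℕ-injective (+-cancelʳ-≡ (signed p true) _ _
  (suc-injective (trans (signed-mirror p false)
    (trans (sym (signed-mirror q false)) (cong (λ x → suc (toℕ q + x)) (sym eq)))))) , refl
signed-injective {m} p q false true  eq = contradiction (signed-mirror q false) (<⇒≢ (begin-strict
  suc (toℕ q + signed q true)   ≡⟨ cong (λ x → suc (toℕ q + x)) eq ⟨
  suc (toℕ q) + toℕ p           <⟨ +-mono-≤-< (toℕ<n q) (toℕ<n p) ⟩
  m + m                         ≡⟨ double m ⟩
  m * 2                         ∎))
  where
  open ≤-Reasoning
  double : ∀ m → m + m ≡ m * 2
  double = solve-∀
signed-injective p q true false eq with signed-injective q p false true (sym eq)
... | ()

signed-onto : ∀ {k} → k < m * 2 → ∃[ p ] ∃[ b ] signed {m} p b ≡ k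
signed-onto {m} {k} k< with k <? m
... | yes k<m = fromℕ< k<m , false , toℕ-fromℕ< k<m
... | no k≮m = fromℕ< k′<m , true
  , trans (cong (λ x → m * 2 ∸ suc x) (toℕ-fromℕ< k′<m)) (trans (cong (_∸ suc k′) (sym sum)) (m+n∸n≡m k (suc k′)))
  where
  k′ = m * 2 ∸ suc k
  sum : k + suc k′ ≡ m * 2
  sum = trans (+-suc k k′) (m+[n∸m]≡n k<)
  k′<m : k′ < m
  k′<m = +-cancelˡ-≤ m _ _ (begin
    m + suc k′   ≤⟨ +-monoˡ-≤ (suc k′) (≮⇒≥ k≮m) ⟩
    k + suc k′   ≡⟨ sum ⟩
    m * 2        ≡⟨ double m ⟩
    m + m        ∎)
    where
    open ≤-Reasoning
    double : ∀ m → m * 2 ≡ m + m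
    double = solve-∀

xor-cancelʳ : ∀ a b → (a xor b) xor b ≡ a
xor-cancelʳ a b = trans (xor-assoc a b b) (trans (cong (a xor_) (xor-same b)) (xor-identityʳ a))

xor-injectiveʳ : ∀ c {a b} → a xor c ≡ b xor c → a ≡ b
xor-injectiveʳ c {a} {b} eq = trans (sym (xor-cancelʳ a c)) (trans (cong (_xor c) eq) (xor-cancelʳ b c))

xor-injectiveˡ : ∀ c {a b} → c xor a ≡ c xor b → a ≡ b
xor-injectiveˡ false eq = eq
xor-injectiveˡ true  {a} {b} eq = trans (sym (not-involutive a)) (trans (cong not eq) (not-involutive b))

side-column : ∀ s h → side (column s h) ≡ s
side-column false false = refl
side-column false true  = refl
side-column true  false = refl
side-column true  true  = refl

high-column : ∀ s h → high (column s h) ≡ h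
high-column false false = refl
high-column false true  = refl
high-column true  false = refl
high-column true  true  = refl

column-side-high : ∀ j → column (side j) (high j) ≡ j
column-side-high 0F = refl
column-side-high 1F = refl
column-side-high 2F = refl
column-side-high 3F = refl

row-side-high : ∀ (x : Fin 4 → ℕ) p j → row x p (side j) (high j xor p) ≡ x j
row-side-high x p j = cong x (trans (cong (column (side j)) (xor-cancelʳ (high j) p)) (column-side-high j))

-- `step` gives the other entry on the same side and `mirror` carries both across, so one entry per
-- row determines a labeling that obeys the laws.
rowLaw-unique : ∀ {e T y y′} → RowLaw e T y → RowLaw e T y′ → y false false ≡ y′ false false → ∀ s h → y s h ≡ y′ s h
rowLaw-unique {e} {T} {y} {y′} law law′ eq = go
  where
  mirrored : ∀ h → y false h ≡ y′ false h → y true (not h) ≡ y′ true (not h)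
  mirrored h p = +-cancelˡ-≡ (y false h) _ _
    (trans (law .mirror h) (trans (sym (law′ .mirror h)) (cong (_+ y′ true (not h)) (sym p))))
  eq′ : y false true ≡ y′ false true
  eq′ = trans (law .step false) (trans (cong (_+ e) eq) (sym (law′ .step false)))
  go : ∀ s h → y s h ≡ y′ s h
  go false false = eq
  go false true  = eq′
  go true  false = mirrored true eq′
  go true  true  = mirrored false eq

-- Labelings built from a distance, an order and orientations

module _ {e D : ℕ} .{{_ : NonZero e}} (De≡2m : D * e ≡ m * 2) where

  slot-signed-mirror : ∀ h p b → suc (slot e h (signed p b) + slot e (not h) (signed {m} p (not b))) ≡ m * 4
  slot-signed-mirror h p b = begin
    suc (slot e h (signed p b) + slot e (not h) (signed p (not b)))
      ≡⟨ slot-mirror e D h (trans (signed-mirror p b) (sym De≡2m)) ⟩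
    D * 2 * e    ≡⟨ rearrange D e ⟩
    D * e * 2    ≡⟨ cong (_* 2) De≡2m ⟩
    m * 2 * 2    ≡⟨ *-assoc m 2 2 ⟩
    m * 4        ∎
    where
    open ≡-Reasoning
    rearrange : ∀ D e → D * 2 * e ≡ D * e * 2
    rearrange = solve-∀

-- Position `signed zero true` is 2m - 1, whose slot `true` is the mirror image of the value 0. So
-- 4m stands at the origin exactly when row 0 has orbit `zero` and orientation `true`.
topSlot : ∀ {e D} .{{_ : NonZero e}} → D * e ≡ suc n * 2 → suc (slot e true (signed {suc n} zero true)) ≡ suc n * 4
topSlot {n} {e} {D} De≡2m = begin
  suc (slot e true k)                   ≡⟨ cong suc (+-identityʳ (slot e true k)) ⟨
  suc (slot e true k + 0)               ≡⟨ cong (λ z → suc (slot e true k + z)) (slot-small e (>-nonZero⁻¹ e)) ⟨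
  suc (slot e true k + slot e false 0)  ≡⟨ slot-signed-mirror {suc n} {e} {D} De≡2m true zero true ⟩
  suc n * 4                             ∎
  where
  open ≡-Reasoning
  k = signed {suc n} zero true

-- Row `i` receives the reflection orbit `π i` in orientation `t i`, and `high j xor parity i`
-- separates upper from lower entries. Changing the side passes to the other member of the orbit;
-- combined with exchanging upper and lower, this is the reflection that `mirror` asks for.
arrange : (e : ℕ) .{{_ : NonZero e}} → (Fin m → Fin m) → (Fin m → Bool) → Labeling m 4
arrange e π t (i , j) = suc (slot e (high j xor parity i) (signed (π i) (t i xor side j)))

module _ {e : ℕ} .{{_ : NonZero e}} (π : Fin m → Fin m) (t : Fin m → Bool) where

  arrange-row : ∀ i s h → row (λ j → arrange e π t (i , j)) (parity i) s h ≡ suc (slot e h (signed (π i) (t i xor s)))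
  arrange-row i s h = cong₂ (λ a b → suc (slot e a (signed (π i) (t i xor b))))
    (trans (cong (_xor parity i) (high-column s _)) (xor-cancelʳ h (parity i))) (side-column s (h xor parity i))

  module _ {D : ℕ} (De≡2m : D * e ≡ m * 2) where

    arrange-rowLaw : ∀ i → RowLaw e (suc (m * 4)) (row (λ j → arrange e π t (i , j)) (parity i))
    arrange-rowLaw i = record
      { step   = λ s → trans (arrange-row i s true) (trans (cong suc (slot-true e _)) (cong (_+ e) (sym (arrange-row i s false))))
      ; mirror = λ h → trans (cong₂ _+_ (arrange-row i false h) (arrange-row i true (not h))) (mirrored h (t i))
      }
      where
      mirrored : ∀ h b → suc (slot e h (signed (π i) (b xor false))) + suc (slot e (not h) (signed (π i) (b xor true)))
                 ≡ suc (m * 4)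
      mirrored h false = cong suc (trans (+-suc _ _) (slot-signed-mirror {D = D} De≡2m h (π i) false))
      mirrored h true  = cong suc (trans (+-suc _ _) (slot-signed-mirror {D = D} De≡2m h (π i) true))

    arrange-isLabeling : Injective _≡_ _≡_ π → IsLabeling (arrange e π t)
    arrange-isLabeling π-inj = isLabeling (arrange e π t) range inj
      where
      range : ∀ v → 1 ≤ arrange e π t v × arrange e π t v ≤ m * 4
      range (i , j) = s≤s z≤n
        , ≤-trans (s≤s (m≤m+n _ _)) (≤-reflexive (slot-signed-mirror {D = D} De≡2m (high j xor parity i) (π i) (t i xor side j)))

      inj : Injective _≡_ _≡_ (arrange e π t)
      inj {i , j} {i′ , j′} eq
        with p , q ← slot-injective e (high j xor parity i) (high j′ xor parity i′) _ _ (suc-injective eq)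
        with r , s ← signed-injective (π i) (π i′) (t i xor side j) (t i′ xor side j′) q
        with refl ← π-inj r
        = cong (i ,_) (trans (sym (column-side-high j))
            (trans (cong₂ column (xor-injectiveˡ (t i) s) (xor-injectiveʳ (parity i) p)) (column-side-high j′)))

-- The distance is the gap between columns 2 and 0 of row 0. Once the distances agree, column 0 of
-- every row can be decoded.
arrange-injective : ∀ {e e′} .{{_ : NonZero e}} .{{_ : NonZero e′}} {π π′ : Fin (suc n) → Fin (suc n)} {t t′} →
  (∀ v → arrange e π t v ≡ arrange e′ π′ t′ v) → e ≡ e′ × (∀ i → π i ≡ π′ i × t i ≡ t′ i)
arrange-injective {n} {e} {e′} {{e≢0}} {π = π} {π′} {t} {t′} eq = e≡e′ , λ i → rest e≡e′ i (eq (i , 0F))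
  where
  k  = signed (π zero) (t zero xor false)
  k′ = signed (π′ zero) (t′ zero xor false)
  e≡e′ : e ≡ e′
  e≡e′ = +-cancelˡ-≡ (slot e false k) _ _ (begin
    slot e false k + e      ≡⟨ slot-true e k ⟨
    slot e true k           ≡⟨ suc-injective (eq (zero , 0F)) ⟩
    slot e′ true k′         ≡⟨ slot-true e′ k′ ⟩
    slot e′ false k′ + e′   ≡⟨ cong (_+ e′) (suc-injective (eq (zero , 2F))) ⟨
    slot e false k + e′     ∎)
    where open ≡-Reasoning
  rest : e ≡ e′ → ∀ i → arrange e π t (i , 0F) ≡ arrange e′ π′ t′ (i , 0F) → π i ≡ π′ i × t i ≡ t′ i
  rest refl i p =
    let q , r = signed-injective (π i) (π′ i) _ _
                  (proj₂ (slot-injective e {{e≢0}} (true xor parity i) (true xor parity i)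
                    (signed (π i) (t i xor false)) (signed (π′ i) (t′ i xor false)) (suc-injective p)))
    in q , xor-injectiveʳ false r

-- Every normalised labeling has this form

record Arranged (X : Labeling (suc n) 4) : Set where
  field
    {e D}       : ℕ
    {{e≢0}}     : NonZero e
    De≡2m       : D * e ≡ suc n * 2
    π           : Fin (suc n) → Fin (suc n)
    t           : Fin (suc n) → Bool
    π-injective : Injective _≡_ _≡_ π
    π-zero      : π zero ≡ zero
    t-zero      : t zero ≡ true
    arranged    : ∀ v → X v ≡ arrange e π t v

module _ (X : Labeling (suc n) 4) (labeling : IsLabeling X) (top : X origin ≡ suc n * 4)
         {e T : ℕ} {{e≢0 : NonZero e}} (laws : RowLaws e T X) where

  private
    m′ : ℕ
    m′ = suc n

    range : ∀ v → 1 ≤ X v × X v ≤ m′ * 4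
    range = proj₁ labeling

    X-injective : Injective _≡_ _≡_ X
    X-injective = proj₁ (proj₂ labeling)

    X-onto : ∀ k → 1 ≤ k → k ≤ m′ * 4 → ∃[ v ] X v ≡ k
    X-onto = proj₂ (proj₂ labeling)

    y : Fin m′ → Bool → Bool → ℕ
    y i = row (λ j → X (i , j)) (parity i)

    y-mirror : ∀ i s h → y i s h + y i (not s) (not h) ≡ T
    y-mirror i false h = laws i .mirror h
    y-mirror i true  h = trans (+-comm (y i true h) _)
      (trans (cong (λ h′ → y i false (not h) + y i true h′) (sym (not-involutive h))) (laws i .mirror (not h)))

    complement : ∀ v → ∃[ u ] X v + X u ≡ T
    complement (i , j) = (i , column (not (side j)) (not (high j xor parity i) xor parity i)) ,
      trans (cong (_+ y i (not (side j)) (not (high j xor parity i))) (sym (row-side-high (λ j → X (i , j)) (parity i) j)))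
        (y-mirror i (side j) (high j xor parity i))

    -- The labels 1 and 4m have complements in the range 1,…,4m.
    T≡ : T ≡ suc (m′ * 4)
    T≡ =
      let v , Xv≡1 = X-onto 1 (s≤s z≤n) (s≤s z≤n)
          u , sum  = complement origin
          u′ , sum′ = complement v
      in ≤-antisym
        (≤-trans (≤-reflexive (trans (sym sum′) (cong (_+ X u′) Xv≡1))) (s≤s (proj₂ (range u′))))
        (≤-trans (≤-reflexive (+-comm 1 (m′ * 4)))
          (≤-trans (+-mono-≤ (≤-reflexive (sym top)) (proj₁ (range u))) (≤-reflexive sum)))

    -- Vertices by row, side and upper or lower entry; in these coordinates the matching only
    -- negates the last component.
    V : Set
    V = Fin m′ × Bool × Bool

    place : V → Vertex m′ 4
    place (i , s , h) = i , column s (h xor parity i)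

    Z : V → ℕ
    Z v = pred (X (place v))

    suc-Z : ∀ v → suc (Z v) ≡ X (place v)
    suc-Z v = suc-pred (X (place v)) {{>-nonZero (proj₁ (range (place v)))}}

    Z<4m : ∀ v → Z v < m′ * 4
    Z<4m v = ≤-trans (≤-reflexive (suc-Z v)) (proj₂ (range (place v)))

    place-injective : Injective _≡_ _≡_ place
    place-injective {i , s , h} {i′ , s′ , h′} eq with refl ← cong proj₁ eq =
      cong₂ (λ a b → i , a , b)
        (trans (sym (side-column s _)) (trans (cong side (cong proj₂ eq)) (side-column s′ _)))
        (xor-injectiveʳ (parity i) (trans (sym (high-column s _)) (trans (cong high (cong proj₂ eq)) (high-column s′ _))))

    Z-injective : Injective _≡_ _≡_ Z
    Z-injective {u} {v} eq = place-injective (X-injective (trans (sym (suc-Z u)) (trans (cong suc eq) (suc-Z v))))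

    Z-onto : ∀ k → k < m′ * 4 → ∃[ v ] Z v ≡ k
    Z-onto k k< =
      let (i , j) , eq = X-onto (suc k) (s≤s z≤n) k<
      in (i , side j , high j xor parity i)
       , suc-injective (trans (suc-Z (i , side j , high j xor parity i))
           (trans (row-side-high (λ j → X (i , j)) (parity i) j) eq))

    upper : V → Bool
    upper (_ , _ , h) = h

    partner : V → V
    partner (i , s , h) = i , s , not h

    Z-step : ∀ i s → Z (i , s , true) ≡ Z (i , s , false) + e
    Z-step i s = suc-injective (trans (suc-Z (i , s , true))
      (trans (laws i .step s) (cong (_+ e) (sym (suc-Z (i , s , false))))))

    ascend : ∀ v → upper v ≡ false → Z (partner v) ≡ Z v + e
    ascend (i , s , false) _ = Z-step i s

    descend : ∀ v → upper v ≡ true → Z v ≡ Z (partner v) + e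
    descend (i , s , true) _ = Z-step i s

    module Pairs = Matching (m′ * 4) e Z Z<4m Z-injective Z-onto upper partner (λ _ → refl) ascend descend

    -- `κ i` is the slot index of one lower entry of row `i`. By `rowLaw-unique` it determines the
    -- row, so it is enough to read each `κ i` as a signed orbit.
    module Coordinates (D : ℕ) (2De≡4m : D * 2 * e ≡ m′ * 4)
                       (κ : Fin m′ → ℕ) (Z≡slot : ∀ i → Z (i , false , false) ≡ slot e false (κ i)) where

      De≡2m : D * e ≡ m′ * 2
      De≡2m = *-cancelʳ-≡ _ _ 2 (trans (rearrange D e) (trans 2De≡4m (sym (*-assoc m′ 2 2))))
        where
        rearrange : ∀ D e → D * e * 2 ≡ D * 2 * e
        rearrange = solve-∀

      position : ∀ i → ∃[ p ] ∃[ b ] signed {m′} p b ≡ κ i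
      position i = signed-onto {m′} (subst (κ i <_) De≡2m (slot-bound e D false (κ i)
        (subst₂ _<_ (Z≡slot i) (sym 2De≡4m) (Z<4m (i , false , false)))))

      π : Fin m′ → Fin m′
      π i = proj₁ (position i)

      t : Fin m′ → Bool
      t i = proj₁ (proj₂ (position i))

      rowForm : ∀ i s h → y i s h ≡ row (λ j → arrange e π t (i , j)) (parity i) s h
      rowForm i = rowLaw-unique (subst (λ T → RowLaw e T (y i)) T≡ (laws i)) (arrange-rowLaw π t {D} De≡2m i) (begin
        y i false false                                        ≡⟨ suc-Z (i , false , false) ⟨
        suc (Z (i , false , false))                            ≡⟨ cong suc (Z≡slot i) ⟩
        suc (slot e false (κ i))                               ≡⟨ cong (λ k → suc (slot e false k)) (proj₂ (proj₂ (position i))) ⟨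
        suc (slot e false (signed (π i) (t i)))                ≡⟨ cong (λ b → suc (slot e false (signed (π i) b))) (xor-identityʳ (t i)) ⟨
        suc (slot e false (signed (π i) (t i xor false)))      ≡⟨ arrange-row π t i false false ⟨
        row (λ j → arrange e π t (i , j)) (parity i) false false ∎)
        where open ≡-Reasoning

      arranged : ∀ v → X v ≡ arrange e π t v
      arranged (i , j) = trans (sym (row-side-high (λ j → X (i , j)) (parity i) j))
        (trans (rowForm i (side j) (high j xor parity i)) (row-side-high (λ j → arrange e π t (i , j)) (parity i) j))

      π-injective : Injective _≡_ _≡_ π
      -- On side `t j xor t i` row `j` shows the orientation `t i`. If the orbits agree, that entry
      -- repeats a label of row `i`, against the injectivity of `X` unless the rows coincide.
      π-injective {i} {j} eq = cong proj₁ (place-injective {i , false , false} {j , t j xor t i , false} (X-injective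
        (trans (trans (rowForm i false false) (arrange-row π t i false false))
          (trans (cong₂ (λ p b → suc (slot e false (signed p b))) eq (shifted (t i) (t j)))
            (sym (trans (rowForm j (t j xor t i) false) (arrange-row π t j (t j xor t i) false)))))))
        where
        shifted : ∀ a b → a xor false ≡ b xor (b xor a)
        shifted a false = xor-identityʳ a
        shifted a true  = trans (xor-identityʳ a) (sym (not-involutive a))

      corner : π zero ≡ zero × t zero xor false ≡ true
      corner = signed-injective (π zero) zero (t zero xor false) true
        (proj₂ (slot-injective e true true (signed (π zero) (t zero xor false)) (signed {m′} zero true)
          (suc-injective (trans (sym (arranged origin)) (trans top (sym (topSlot {n} {e} {D} De≡2m)))))))

      arrangement : Arranged X
      arrangement = record
        { e = e ; D = D ; De≡2m = De≡2m ; π = π ; t = t ; π-injective = π-injective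
        ; π-zero = proj₁ corner ; t-zero = trans (sym (xor-identityʳ (t zero))) (proj₂ corner) ; arranged = arranged }

  rows⇒arrangement : Arranged X
  rows⇒arrangement =
    let D , 2De≡4m = Pairs.divides-length (zero , false , true) (trans (suc-Z (zero , false , true)) top)
    in Coordinates.arrangement D 2De≡4m
         (λ i → proj₁ (Pairs.inSlot (i , false , false))) (λ i → proj₂ (Pairs.inSlot (i , false , false)))

arrangement : (X : Labeling (suc n) 4) → IsMagicLabeling X → X origin ≡ suc n * 4 →
              parity (fromℕ n) ≡ false → Arranged X
arrangement X (labeling@(range , inj , _) , magic) top even =
  -- The origin carries the largest label, so its gap to column 2 is positive and `suc k` serves as
  -- the distance.
  let k , gap  = m≤n⇒∃[o]m+o≡n X₀₂<X₀₀
      T , laws = faces⇒rows X (proj₂ (allFaces X magic)) even (sym (trans (+-suc (X (zero , 2F)) k) gap))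
  in rows⇒arrangement X labeling top laws
  where
  X₀₂<X₀₀ : X (zero , 2F) < X (zero , 0F)
  X₀₂<X₀₀ = ≤∧≢⇒< (≤-trans (proj₂ (range (zero , 2F))) (≤-reflexive (sym top))) λ eq → contradiction (inj eq) λ ()

-- Enumeration

remQuot-injective : ∀ k (a b : Fin (m * k)) → remQuot {m} k a ≡ remQuot {m} k b → a ≡ b
remQuot-injective {m} k a b eq =
  trans (sym (combine-remQuot {m} k a)) (trans (cong (uncurry combine) eq) (combine-remQuot {m} k b))

lookup-injective : ∀ {A : Set} {xs : List A} → Unique xs → Injective _≡_ _≡_ (lookup xs)
lookup-injective (_ ∷ _)  {zero}  {zero}  eq = refl
lookup-injective (x∉ ∷ _) {zero}  {suc j} eq = contradiction eq (All.lookup x∉ (∈-lookup j))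
lookup-injective (x∉ ∷ _) {suc i} {zero}  eq = contradiction (sym eq) (All.lookup x∉ (∈-lookup i))
lookup-injective (_ ∷ u)  {suc i} {suc j} eq = cong suc (lookup-injective u eq)

divisors : ℕ → List ℕ
divisors m = filter (_∣? m) (map suc (upTo m))

divisor : ∀ m → Fin (τ m) → ℕ
divisor m = lookup (divisors m)

divisor∣ : ∀ m (a : Fin (τ m)) → divisor m a ∣ m
divisor∣ m a = proj₂ (∈-filter⁻ (_∣? m) {xs = map suc (upTo m)} (∈-lookup {xs = divisors m} a))

divisor-injective : ∀ m → Injective _≡_ _≡_ (divisor m)
divisor-injective m = lookup-injective (Unique.filter⁺ (_∣? m) (Unique.map⁺ suc-injective (Unique.upTo⁺ m)))

divisor-onto : ∀ {d} → d ∣ suc n → ∃[ a ] divisor (suc n) a ≡ d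
divisor-onto {n} {zero}  d∣m with () ← 0∣⇒≡0 d∣m
divisor-onto {n} {suc d} d∣m = index d∈ , sym (lookup-index d∈)
  where
  d∈ : suc d ∈ divisors (suc n)
  d∈ = ∈-filter⁺ (_∣? suc n) (∈-map⁺ suc (∈-upTo⁺ (∣⇒≤ d∣m))) d∣m

leading : ∀ n → Fin (suc n !) → Fin (suc n)
leading n a = proj₁ (remQuot {suc n} (n !) a)

trailing : ∀ n → Fin (suc n !) → Fin (n !)
trailing n a = proj₂ (remQuot {suc n} (n !) a)

-- The Lehmer code: the leading digit is the image of 0 and the rest encodes a permutation of the
-- remaining values.
permutation : ∀ n → Fin (n !) → Fin n → Fin n
permutation (suc n) a zero    = leading n a
permutation (suc n) a (suc i) = punchIn (leading n a) (permutation n (trailing n a) i)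

permutation-isInjective : ∀ n (a : Fin (n !)) → Injective _≡_ _≡_ (permutation n a)
permutation-isInjective (suc n) a {zero}  {zero}  eq = refl
permutation-isInjective (suc n) a {zero}  {suc j} eq = contradiction (sym eq) (punchInᵢ≢i (leading n a) _)
permutation-isInjective (suc n) a {suc i} {zero}  eq = contradiction eq (punchInᵢ≢i (leading n a) _)
permutation-isInjective (suc n) a {suc i} {suc j} eq =
  cong suc (permutation-isInjective n (trailing n a) (punchIn-injective (leading n a) _ _ eq))

permutation-injective : ∀ n (a b : Fin (n !)) → (∀ i → permutation n a i ≡ permutation n b i) → a ≡ b
permutation-injective zero    zero zero eq = refl
permutation-injective (suc n) a b eq = remQuot-injective {suc n} (n !) a b (cong₂ _,_ (eq zero)
  (permutation-injective n (trailing n a) (trailing n b) λ i → punchIn-injective (leading n a) _ _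
    (trans (eq (suc i)) (cong (λ p → punchIn p (permutation n (trailing n b) i)) (sym (eq zero))))))

permutation-onto : ∀ n (f : Fin n → Fin n) → Injective _≡_ _≡_ f → ∃[ a ] (∀ i → permutation n a i ≡ f i)
permutation-onto zero    f inj = zero , λ ()
permutation-onto (suc n) f inj = a , agrees
  where
  f₀≢ : ∀ i → f zero ≢ f (suc i)
  f₀≢ i eq = contradiction (inj eq) Fin.0≢1+n
  rest : ∃[ a ] (∀ i → permutation n a i ≡ punchOut (f₀≢ i))
  rest = permutation-onto n (λ i → punchOut (f₀≢ i))
    λ {i} {j} eq → Fin.suc-injective (inj (punchOut-injective (f₀≢ i) (f₀≢ j) eq))
  a : Fin (suc n !)
  a = combine (f zero) (proj₁ rest)
  agrees : ∀ i → permutation (suc n) a i ≡ f i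
  agrees zero    = cong proj₁ (remQuot-combine {suc n} {n !} (f zero) (proj₁ rest))
  agrees (suc i) = trans
    (cong (λ (p , a) → punchIn p (permutation n a i)) (remQuot-combine {suc n} {n !} (f zero) (proj₁ rest)))
    (trans (cong (punchIn (f zero)) (proj₂ rest i)) (punchIn-punchOut (f₀≢ i)))

bits : ∀ m → Fin (2 ^ m) → Fin m → Bool
bits m a i = Inverse.to 2↔Bool (finToFun {2} {m} a i)

bits-injective : ∀ m (a b : Fin (2 ^ m)) → (∀ i → bits m a i ≡ bits m b i) → a ≡ b
bits-injective m a b eq = trans (sym (funToFin-finToFin {m} {2} a))
  (trans (funToFin-cong (λ i → trans (sym (strictlyInverseʳ (finToFun {2} {m} a i)))
    (trans (cong from (eq i)) (strictlyInverseʳ (finToFun {2} {m} b i))))) (funToFin-finToFin {m} {2} b))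
  where
  open Inverse 2↔Bool using (from; strictlyInverseʳ)
  funToFin-cong : ∀ {k} {f g : Fin k → Fin 2} → (∀ i → f i ≡ g i) → funToFin f ≡ funToFin g
  funToFin-cong {zero}  eq = refl
  funToFin-cong {suc k} eq = cong₂ combine (eq zero) (funToFin-cong (eq ∘ suc))

bits-onto : ∀ m (f : Fin m → Bool) → ∃[ a ] (∀ i → bits m a i ≡ f i)
bits-onto m f = funToFin (from ∘ f) , λ i →
  trans (cong to (finToFun-funToFin (from ∘ f) i)) (strictlyInverseˡ (f i))
  where open Inverse 2↔Bool using (from; to; strictlyInverseˡ)

-- For odd m the divisors of 2m are the numbers d and 2d with d dividing m, without repetition.
scale : Bool → ℕ → ℕ
scale false d = d
scale true  d = d * 2

scale∣ : ∀ b {d} → d ∣ m → ∃[ D ] D * scale b d ≡ m * 2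
scale∣ {m} false {d} (divides q refl) = q * 2 , rearrange q d
  where
  rearrange : ∀ q d → q * 2 * d ≡ q * d * 2
  rearrange = solve-∀
scale∣ {m} true  {d} (divides q refl) = q , sym (*-assoc q d 2)

module _ (odd : m % 2 ≡ 1) where

  2∤divisor : ∀ {d} d′ → d ∣ m → d ≢ d′ * 2
  2∤divisor d′ d∣m refl = contradiction (trans (sym odd) (n∣m⇒m%n≡0 m 2 (∣-trans (n∣m*n d′) d∣m))) λ ()

  -- A divisor of an odd number is odd, so the parity of the distance reveals the bit.
  scale-injective : ∀ b b′ {d d′} → d ∣ m → d′ ∣ m → scale b d ≡ scale b′ d′ → b ≡ b′ × d ≡ d′
  scale-injective false false p p′ eq = refl , eq
  scale-injective false true  {d′ = d′} p p′ eq = contradiction eq (2∤divisor d′ p)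
  scale-injective true  false {d} p p′ eq = contradiction (sym eq) (2∤divisor d p′)
  scale-injective true  true  p p′ eq = refl , *-cancelʳ-≡ _ _ 2 eq

  -- By Euclid's lemma 2 divides the cofactor or the distance; halving that factor leaves a
  -- factorisation of m.
  scale-onto : ∀ {e D} → D * e ≡ m * 2 → ∃[ b ] ∃[ d ] d ∣ m × scale b d ≡ e
  scale-onto {e} {D} eq with euclidsLemma D e prime[2] (divides m eq)
  ... | inj₁ (divides q refl) = false , e , divides q (*-cancelʳ-≡ m (q * e) 2 (trans (sym eq) (rearrange q e))) , refl
    where
    rearrange : ∀ q e → q * 2 * e ≡ q * e * 2
    rearrange = solve-∀
  ... | inj₂ (divides q refl) = true , q , divides D (*-cancelʳ-≡ m (D * q) 2 (trans (sym eq) (sym (*-assoc D q 2)))) , refl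

scale≢0 : ∀ b {d} → d ∣ suc n → NonZero (scale b d)
scale≢0 b     {suc d} d∣m with b
... | false = _
... | true  = _
scale≢0 b     {zero}  d∣m with () ← 0∣⇒≡0 d∣m

-- The system of representatives

module Representatives (n : ℕ) (odd : suc n % 2 ≡ 1) where

  even : parity (fromℕ n) ≡ false
  even = parity-fromℕ n odd

  Code : Set
  Code = Fin (2 ^ suc n * n ! * τ (suc n))

  decode : Code → (Fin (2 ^ suc n) × Fin (n !)) × Fin (τ (suc n))
  decode a = let so , d = remQuot {2 ^ suc n * n !} (τ (suc n)) a in remQuot {2 ^ suc n} (n !) so , d

  encode : (Fin (2 ^ suc n) × Fin (n !)) × Fin (τ (suc n)) → Code
  encode ((s , o) , d) = combine (combine s o) d

  decode-encode : ∀ c → decode (encode c) ≡ c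
  decode-encode ((s , o) , d) = trans
    (cong (λ (so , d) → remQuot {2 ^ suc n} (n !) so , d) (remQuot-combine {2 ^ suc n * n !} {τ (suc n)} (combine s o) d))
    (cong (_, d) (remQuot-combine {2 ^ suc n} {n !} s o))

  decode-injective : ∀ a b → decode a ≡ decode b → a ≡ b
  decode-injective a b eq = remQuot-injective {2 ^ suc n * n !} (τ (suc n)) a b
    (cong₂ _,_ (remQuot-injective {2 ^ suc n} (n !) _ _ (cong proj₁ eq)) (cong proj₂ eq))

  signBits : Code → Fin (suc n) → Bool
  signBits a = bits (suc n) (proj₁ (proj₁ (decode a)))

  divisorOf : Code → ℕ
  divisorOf a = divisor (suc n) (proj₂ (decode a))

  divisorOf∣ : ∀ a → divisorOf a ∣ suc n
  divisorOf∣ a = divisor∣ (suc n) (proj₂ (decode a))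

  -- The sign of row 0 is forced, so its bit is free to choose between the
  -- divisors d and 2d of 2m.
  distance : Code → ℕ
  distance a = scale (signBits a zero) (divisorOf a)

  distance≢0 : ∀ a → NonZero (distance a)
  distance≢0 a = scale≢0 (signBits a zero) (divisorOf∣ a)

  order : Code → Fin (suc n) → Fin (suc n)
  order a zero    = zero
  order a (suc i) = suc (permutation n (proj₂ (proj₁ (decode a))) i)

  sign : Code → Fin (suc n) → Bool
  sign a zero    = true
  sign a (suc i) = signBits a (suc i)

  order-isInjective : ∀ a → Injective _≡_ _≡_ (order a)
  order-isInjective a {zero}  {zero}  eq = refl
  order-isInjective a {suc i} {suc j} eq = cong suc (permutation-isInjective n (proj₂ (proj₁ (decode a))) (Fin.suc-injective eq))

  representative : Code → Labeling (suc n) 4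
  representative a = arrange (distance a) {{distance≢0 a}} (order a) (sign a)

  codistance : ∀ a → ∃[ D ] D * distance a ≡ suc n * 2
  codistance a = scale∣ (signBits a zero) (divisorOf∣ a)

  representative-magic : ∀ a → IsMagicLabeling (representative a)
  representative-magic a =
    let D , De≡2m = codistance a
        instance _ = distance≢0 a
    in arrange-isLabeling (order a) (sign a) {D} De≡2m (order-isInjective a)
     , isFaceMagic (representative a) (rows⇒faces (representative a) even (arrange-rowLaw (order a) (sign a) {D} De≡2m))

  representative-origin : ∀ a → representative a origin ≡ suc n * 4
  representative-origin a = topSlot {n} {distance a} {proj₁ (codistance a)} {{distance≢0 a}} (proj₂ (codistance a))

  representative-injective : ∀ a b → (∀ v → representative a v ≡ representative b v) → a ≡ b
  representative-injective a b eq =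
    let e≡ , rows = arrange-injective {{distance≢0 a}} {{distance≢0 b}} {t = sign a} {sign b} eq
        b≡ , d≡ = scale-injective odd (signBits a zero) (signBits b zero)
                    (divisorOf∣ a) (divisorOf∣ b) e≡
    in decode-injective a b (cong₂ _,_ (cong₂ _,_
         (bits-injective (suc n) _ _ λ { zero → b≡ ; (suc i) → proj₂ (rows (suc i)) })
         (permutation-injective n _ _ λ i → Fin.suc-injective (proj₁ (rows (suc i)))))
         (divisor-injective (suc n) d≡))

  arrange-cong : ∀ {e e′} .{{_ : NonZero e}} .{{_ : NonZero e′}} {π π′ : Fin (suc n) → Fin (suc n)} {t t′} →
    e ≡ e′ → (∀ i → π i ≡ π′ i) → (∀ i → t i ≡ t′ i) → ∀ v → arrange e π t v ≡ arrange e′ π′ t′ v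
  arrange-cong {e} {{e≢0}} refl π≡ t≡ (i , j) =
    cong₂ (λ p b → suc (slot e {{e≢0}} (high j xor parity i) (signed p (b xor side j)))) (π≡ i) (t≡ i)

  representative-onto : ∀ {X} → Arranged X → ∃[ a ] (∀ v → X v ≡ representative a v)
  representative-onto A = a , λ v → trans (arranged v) (arrange-cong {{e≢0}} {{distance≢0 a}} e≡ π≡ t≡ v)
    where
    open Arranged A

    scaled : ∃[ b ] ∃[ d ] d ∣ suc n × scale b d ≡ e
    scaled = scale-onto odd {e} {D} De≡2m

    π≢0 : ∀ i → zero ≢ π (suc i)
    π≢0 i eq = contradiction (π-injective (trans π-zero eq)) Fin.0≢1+n

    signs : Fin (suc n) → Bool
    signs zero    = proj₁ scaled
    signs (suc i) = t (suc i)

    s : ∃[ c ] (∀ i → bits (suc n) c i ≡ signs i)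
    s = bits-onto (suc n) signs

    o : ∃[ c ] (∀ i → permutation n c i ≡ punchOut (π≢0 i))
    o = permutation-onto n (λ i → punchOut (π≢0 i))
      λ {i} {j} eq → Fin.suc-injective (π-injective (punchOut-injective (π≢0 i) (π≢0 j) eq))

    d : ∃[ c ] divisor (suc n) c ≡ proj₁ (proj₂ scaled)
    d = divisor-onto (proj₁ (proj₂ (proj₂ scaled)))

    a : Code
    a = encode ((proj₁ s , proj₁ o) , proj₁ d)

    decoded : decode a ≡ ((proj₁ s , proj₁ o) , proj₁ d)
    decoded = decode-encode ((proj₁ s , proj₁ o) , proj₁ d)

    bits≡ : ∀ i → signBits a i ≡ signs i
    bits≡ i = trans (cong (λ ((c , _) , _) → bits (suc n) c i) decoded) (proj₂ s i)

    e≡ : e ≡ distance a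
    e≡ = trans (sym (proj₂ (proj₂ (proj₂ scaled))))
      (cong₂ scale (sym (bits≡ zero))
        (sym (trans (cong (λ (_ , c) → divisor (suc n) c) decoded) (proj₂ d))))

    π≡ : ∀ i → π i ≡ order a i
    π≡ zero    = π-zero
    π≡ (suc i) = trans (sym (punchIn-punchOut (π≢0 i))) (cong suc (sym
      (trans (cong (λ ((_ , c) , _) → permutation n c i) decoded) (proj₂ o i))))

    t≡ : ∀ i → t i ≡ sign a i
    t≡ zero    = t-zero
    t≡ (suc i) = sym (bits≡ (suc i))

  -- Both labelings carry 4m at the origin, so by injectivity the connecting word fixes the origin.
  -- It then acts trivially and the labelings coincide.
  representative-inequivalent : ∀ a b → KBEquivalent (representative a) (representative b) → a ≡ b
  representative-inequivalent a b (w , eq) = representative-injective a b λ v →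
    sym (trans (eq v) (cong (representative a) (fixes-origin⇒id w fixed v)))
    where
    fixed : act w origin ≡ origin
    fixed = proj₁ (proj₂ (proj₁ (representative-magic a)))
      (trans (sym (eq origin)) (trans (representative-origin b) (sym (representative-origin a))))

  -- A word carrying the origin to the vertex labelled 4m normalises `X`; its inverse leads from the
  -- representative back to `X`.
  representative-complete : ∀ X → IsMagicLabeling X → ∃[ a ] KBEquivalent (representative a) X
  representative-complete X magic =
    let v , Xv≡ = proj₂ (proj₂ (proj₁ magic)) (suc n * 4) (s≤s z≤n) ≤-refl
        w , w-origin = fromOrigin v
        w′ , inv = inverse w
        a , eq = representative-onto (arrangement (applyTo w X) (applyTo-magic w X magic) (trans (cong X w-origin) Xv≡) even)
    in a , w′ , λ u → trans (cong X (sym (trans (act-comm w w′ u) (inv u)))) (eq (act w′ u))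

theorem5p3 : (m : ℕ) → 3 ≤ m → m % 2 ≡ 1 →
    NumberOfClasses m 4 (2 ^ m * (m ∸ 1) ! * τ m)
theorem5p3 (suc n) _ odd = representative , representative-magic , representative-inequivalent , representative-complete
  where open Representatives n odd
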